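{- For every odd positive integer $n$, there are at most $2^{\left\lceil \frac{n}{30}\right\rceil}$ multi-symmetric Steinhaus matrices of size $n$ whose associated Steinhaus graphs are regular modulo $4$.
   Context: A Steinhaus matrix of size $n\geq1$ is a matrix $M=(a_{i,j})_{1\leq i,j\leq n}$ with entries in $\mathbb{F}_2=\{0,1\}$ such that $a_{i,i}=0$ for all $i$, $a_{i,j}=a_{i-1,j-1}+a_{i-1,j}$ (addition in $\mathbb{F}_2$) for all $2\leq i<j\leq n$, and $a_{i,j}=a_{j,i}$ for all $i,j$. The associated Steinhaus graph is the simple graph on vertices $V_1,\ldots,V_n$ with adjacency matrix $M$. A graph is regular modulo $4$ if all its vertex degrees are congruent modulo $4$. A square matrix $(a_{i,j})$ of size $n$ is doubly-symmetric if $a_{i,j}=a_{j,i}=a_{n-j+1,n-i+1}$ for all $i,j$; it is multi-symmetric if it is doubly-symmetric and $a_{i,j}=a_{i,n-j+i+1}$ for all $1\leq i<j\leq n$. -}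

module Defs where

open import Data.Nat using (ℕ; zero; suc; _+_; _<_; _≤_; _^_)
open import Data.Nat.DivMod using (_/_; _%_)
open import Data.Bool using (Bool; true; false; if_then_else_; _xor_)
open import Data.Fin using (Fin; toℕ; opposite)
open import Data.List using (List; map; allFin; length)
open import Data.Nat.ListAction using (sum)
open import Data.List.Relation.Unary.All using (All)
open import Data.List.Relation.Unary.AllPairs using (AllPairs)
open import Data.Product using (_×_)
open import Relation.Binary.PropositionalEquality using (_≡_)
open import Relation.Nullary using (¬_)

-- A square matrix of size n over F₂ = Bool (false = 0, true = 1, xor = addition).
-- Indices are 0-based: Fin n, entry a_{i,j} (1-based) is M (i-1) (j-1).
Matrix : ℕ → Set
Matrix n = Fin n → Fin n → Bool

IsSteinhaus : ∀ {n} → Matrix n → Set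
IsSteinhaus {n} M =
  (∀ i → M i i ≡ false) ×
  (∀ (i j i' j' : Fin n) → toℕ i ≡ suc (toℕ i') → toℕ j ≡ suc (toℕ j') →
     toℕ i < toℕ j → M i j ≡ (M i' j' xor M i' j)) ×
  (∀ i j → M i j ≡ M j i)

-- Doubly-symmetric: a_{i,j} = a_{j,i} = a_{n-j+1,n-i+1};
-- with 0-based indices, n-j+1 corresponds to 'opposite j' (toℕ = n-1-j).
IsDoublySymmetric : ∀ {n} → Matrix n → Set
IsDoublySymmetric {n} M =
  ∀ i j → (M i j ≡ M j i) × (M i j ≡ M (opposite j) (opposite i))

-- Multi-symmetric: doubly-symmetric and a_{i,j} = a_{i,n-j+i+1} for 1 ≤ i < j ≤ n.
-- 0-based: column k with k + j = n + i.
IsMultiSymmetric : ∀ {n} → Matrix n → Set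
IsMultiSymmetric {n} M =
  IsDoublySymmetric M ×
  (∀ (i j k : Fin n) → toℕ i < toℕ j → toℕ k + toℕ j ≡ n + toℕ i → M i j ≡ M i k)

degree : ∀ {n} → Matrix n → Fin n → ℕ
degree {n} M i = sum (map (λ j → if M i j then 1 else 0) (allFin n))

RegularMod4 : ∀ {n} → Matrix n → Set
RegularMod4 M = ∀ i j → degree M i % 4 ≡ degree M j % 4

Distinct : ∀ {n} → Matrix n → Matrix n → Set
Distinct M N = ¬ (∀ i j → M i j ≡ N i j)

ceil30 : ℕ → ℕ
ceil30 n = (n + 29) / 30

{-# OPTIONS --safe #-}
module Submission where

-- The upper triangle of a multi-symmetric Steinhaus matrix of size n = d + 2 has the full
-- symmetry of a triangle. Every row but the first is a palindrome with vanishing centre (if it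
-- has a centre), so for odd n the degrees of V_2, …, V_{n-1} are even and half a degree modulo 2
-- is linear in the entries: a half row is a sum of derived entries, and telescopes. If d = 2e +
-- 1, the linear conditions kill all entries at odd distances from the three sides, and the
-- triangle is the double of one of size e + 2 satisfying the same conditions. If d = 2M + 2, all
-- conditions live on g q = tri b 1 (2q), every other entry of the second row: with ∂ the
-- difference operator, they read g (2i) = (∂^i g) i and g (2i+1) = (∂^i g) (i+1), and the
-- symmetry reads g (M-s) = g (s+1) + (∂^s g) 1. The first two determine three quarters of g on
-- [1, M/2] recursively and the last one reflects this range onto [M/2, M]; once g vanishes on [1,
-- M], the first row is constant except at its ends, hence zero because its centre is. This leaves
-- M/8 ≤ n/30 parameters.

open import Defs
open import Algebra.Bundles using (CommutativeRing)
import Algebra.Properties.CommutativeSemigroup as CommutativeSemigroupProperties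
open import Data.Bool using (Bool; true; false; _xor_; if_then_else_; not)
open import Data.Bool.Properties using (xor-same; xor-comm; xor-assoc; xor-identityʳ;
  not-involutive; not-distribˡ-xor; xor-∧-commutativeRing)
open import Data.Fin using (Fin; toℕ; fromℕ<; inject₁; opposite; funToFin; finToFun)
  renaming (suc to fsuc)
open import Data.Fin.Patterns using (0F; 1F; 2F; 3F)
open import Data.Fin.Properties using (toℕ<n; toℕ-injective; toℕ-fromℕ<; fromℕ<-toℕ; toℕ-inject₁;
  opposite-prop; finToFun-funToFin; injective⇒≤)
open import Data.List using (List; []; _∷_; map; length; lookup; tabulate; applyUpTo)
open import Data.List.Membership.Propositional.Properties using (∈-lookup)
open import Data.List.Properties using (map-tabulate; length-map; length-applyUpTo)
open import Data.List.Relation.Unary.All as All using (All; []; _∷_)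
open import Data.List.Relation.Unary.All.Properties using (map⁻; applyUpTo⁻)
open import Data.List.Relation.Unary.AllPairs using (AllPairs; []; _∷_)
open import Data.List.Relation.Unary.Any.Properties using (lookup-index)
open import Data.Nat using (ℕ; zero; suc; _+_; _*_; _∸_; _^_; _<_; _≤_; z≤n; s≤s; NonZero;
  ⌊_/2⌋; _≤?_; _<?_)
open import Data.Nat.DivMod using (_divMod_; result; _/_; _%_; m/n*n≤m; /-monoˡ-≤; m*n/n≡m; m*n%n≡0)
open import Data.Nat.Induction using (<-rec)
open import Data.Nat.ListAction using (sum)
open import Data.Nat.Properties
open import Data.Nat.Tactic.RingSolver using (solve-∀)
open import Data.Product using (_×_; _,_; ∃-syntax; proj₁; proj₂)
open import Function using (_∘_; id; _∋_)
open import Relation.Binary.Definitions using (tri<; tri≈; tri>)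
open import Relation.Binary.PropositionalEquality
open import Relation.Nullary using (¬_; yes; no; contradiction)

open CommutativeSemigroupProperties
  (CommutativeRing.+-commutativeSemigroup xor-∧-commutativeRing)
  renaming (interchange to xor-interchange)

xor-telescope : ∀ p q r → (p xor q) xor (q xor r) ≡ p xor r
xor-telescope p q r = trans (cong ((p xor q) xor_) (xor-comm q r))
  (trans (xor-interchange p q r q) (trans (cong ((p xor r) xor_) (xor-same q)) (xor-identityʳ _)))

xor-cancelʳ : ∀ p q → q ≡ p xor q → p ≡ false
xor-cancelʳ false q e = refl
xor-cancelʳ true false ()
xor-cancelʳ true true ()

xor-false⇒≡ : ∀ p q → p xor q ≡ false → p ≡ q
xor-false⇒≡ false q e = sym e
xor-false⇒≡ true true e = refl

≤-witness : ∀ {m n} k → m + k ≡ n → m ≤ n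
≤-witness {m} k refl = m≤m+n m k

tri : (ℕ → Bool) → ℕ → ℕ → Bool
tri b zero    y = b y
tri b (suc x) y = tri b x y xor tri b x (suc y)

tri-xor : ∀ b c x y → tri (λ i → b i xor c i) x y ≡ tri b x y xor tri c x y
tri-xor b c zero    y = refl
tri-xor b c (suc x) y = trans (cong₂ _xor_ (tri-xor b c x y) (tri-xor b c x (suc y)))
  (xor-interchange (tri b x y) (tri c x y) (tri b x (suc y)) (tri c x (suc y)))

tri-+2 : ∀ b x y → tri b (2 + x) y ≡ tri b x y xor tri b x (2 + y)
tri-+2 b x y = xor-telescope (tri b x y) (tri b x (1 + y)) (tri b x (2 + y))

tri-+4 : ∀ b x y → tri b (4 + x) y ≡ tri b x y xor tri b x (4 + y)
tri-+4 b x y = trans (tri-+2 b (2 + x) y)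
  (trans (cong₂ _xor_ (tri-+2 b x y) (tri-+2 b x (2 + y)))
         (xor-telescope (tri b x y) (tri b x (2 + y)) (tri b x (4 + y))))

tri-stride : ∀ b c → (∀ x y → tri b (c + x) y ≡ tri b x y xor tri b x (c + y)) →
  ∀ a x y → tri b (x * c) (a + y * c) ≡ tri (λ i → b (a + i * c)) x y
tri-stride b c step a zero    y = refl
tri-stride b c step a (suc x) y = trans (step (x * c) (a + y * c)) (cong₂ _xor_
  (tri-stride b c step a x y)
  (trans (cong (tri b (x * c)) (swapˡ c a (y * c))) (tri-stride b c step a x (suc y))))
  where
  swapˡ : ∀ m n o → m + (n + o) ≡ n + (m + o)
  swapˡ = solve-∀

tri-stride₀ : ∀ b c → (∀ x y → tri b (c + x) y ≡ tri b x y xor tri b x (c + y)) →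
  ∀ a x → tri b (x * c) a ≡ tri (λ i → b (a + i * c)) x 0
tri-stride₀ b c step a x =
  trans (cong (tri b (x * c)) (sym (+-identityʳ a))) (tri-stride b c step a x 0)

Vanishes : (ℕ → Bool) → ℕ → ℕ → Set
Vanishes s l u = ∀ i → l ≤ i → i < u → s i ≡ false

tri-vanish : ∀ s x y → Vanishes s y (y + x) → tri s x y ≡ s (y + x)
tri-vanish s zero    y v = cong s (sym (+-identityʳ y))
tri-vanish s (suc x) y v = cong₂ _xor_ left right
  where
  left : tri s x y ≡ false
  left = trans (tri-vanish s x y λ i l u → v i l (<-≤-trans u (+-monoʳ-≤ y (n≤1+n x))))
               (v (y + x) (m≤m+n y x) (+-monoʳ-< y (n<1+n x)))
  right : tri s x (suc y) ≡ s (y + suc x)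
  right = trans (tri-vanish s x (suc y) λ i l u → v i (<⇒≤ l) (subst (i <_) (sym (+-suc y x)) u))
                (cong s (sym (+-suc y x)))

tri-vanish-odd : ∀ s k y → Vanishes s y (y + k * 2) →
  tri s (suc (k * 2)) y ≡ s (y + k * 2) xor s (y + suc (k * 2))
tri-vanish-odd s zero    y v = cong₂ _xor_ (cong s (sym (+-identityʳ y))) (cong s (+-comm 1 y))
tri-vanish-odd s (suc k) y v = trans (tri-+2 s (suc (k * 2)) y) (cong₂ _xor_ left right)
  where
  shift : ∀ m n → suc (suc m) + n ≡ m + suc (suc n)
  shift = solve-∀
  left : tri s (suc (k * 2)) y ≡ false
  left = trans
    (tri-vanish s (suc (k * 2)) y λ i l u → v i l (<-≤-trans u (+-monoʳ-≤ y (n≤1+n _))))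
    (v _ (m≤m+n y _) (+-monoʳ-< y (n<1+n _)))
  right : tri s (suc (k * 2)) (2 + y) ≡ _
  right = trans
    (tri-vanish-odd s k (2 + y) λ i l u → v i (<⇒≤ (<⇒≤ l)) (subst (i <_) (shift y (k * 2)) u))
    (cong₂ _xor_ (cong s (shift y (k * 2))) (cong s (shift y (suc (k * 2)))))

vanish-next : ∀ s k y → Vanishes s y (y + k * 2) →
  s (y + suc (k * 2)) ≡ tri s (suc (k * 2)) y → s (y + k * 2) ≡ false
vanish-next s k y v e = xor-cancelʳ _ _ (trans e (tri-vanish-odd s k y v))

vanish-stride : ∀ s c .{{_ : NonZero c}} y x {t} → Vanishes s y t → y + x * c ≡ t →
  Vanishes (λ i → s (y + i * c)) 0 x
vanish-stride s c y x v refl i _ i<x = v _ (m≤m+n y _) (+-monoʳ-< y (*-monoˡ-< c i<x))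

-- The numbers suc (slot t) are those congruent to 7, 12, 15 or 0 modulo 16: the indices q for
-- which no equation expresses g q through earlier values.
slot : ℕ → ℕ
slot 0 = 6
slot 1 = 11
slot 2 = 14
slot 3 = 15
slot (suc (suc (suc (suc t)))) = 16 + slot t

slot-block : ∀ a j → slot (a * 4 + j) ≡ a * 16 + slot j
slot-block zero    j = refl
slot-block (suc a) j = cong (16 +_) (slot-block a j)

module _ (g : ℕ → Bool) (M : ℕ)
  (even-eq : ∀ i → i * 2 ≤ M → g (i * 2) ≡ tri g i i)
  (odd-eq  : ∀ i → suc (i * 2) ≤ M → g (suc (i * 2)) ≡ tri g i (suc i))
  where

  shrink : ∀ {l l' u} → l ≤ l' → Vanishes g l u → Vanishes g l' u
  shrink p v i q = v i (≤-trans p q)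

  vanish-1mod4 : ∀ k → (1 + k * 4) * 2 ≤ M → Vanishes g 1 (1 + k * 4) → g (1 + k * 4) ≡ false
  vanish-1mod4 k q≤ v = trans (cong g (sym (eq k))) (vanish-next g k (suc (k * 2))
    (subst (Vanishes g _) (sym (eq k)) (shrink (s≤s z≤n) v))
    (trans (cong g (eq′ k)) (even-eq (suc (k * 2)) (≤-trans (≤-witness (k * 4) (le k)) q≤))))
    where
    eq : ∀ k → suc (k * 2) + k * 2 ≡ 1 + k * 4
    eq = solve-∀
    eq′ : ∀ k → suc (k * 2) + suc (k * 2) ≡ suc (k * 2) * 2
    eq′ = solve-∀
    le : ∀ k → suc (k * 2) * 2 + k * 4 ≡ (1 + k * 4) * 2
    le = solve-∀

  vanish-2mod4 : ∀ k → (2 + k * 4) * 2 ≤ M → Vanishes g 1 (2 + k * 4) → g (2 + k * 4) ≡ false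
  vanish-2mod4 k q≤ v = trans (cong g (sym (eq k))) (vanish-next g k (2 + k * 2)
    (subst (Vanishes g _) (sym (eq k)) (shrink (s≤s z≤n) v))
    (trans (cong g (eq′ k)) (odd-eq (suc (k * 2)) (≤-trans (≤-witness (1 + k * 4) (le k)) q≤))))
    where
    eq : ∀ k → 2 + k * 2 + k * 2 ≡ 2 + k * 4
    eq = solve-∀
    eq′ : ∀ k → 2 + k * 2 + suc (k * 2) ≡ suc (suc (k * 2) * 2)
    eq′ = solve-∀
    le : ∀ k → suc (suc (k * 2) * 2) + (1 + k * 4) ≡ (2 + k * 4) * 2
    le = solve-∀

  vanish-3mod8 : ∀ k → (3 + k * 8) * 2 ≤ M → Vanishes g 1 (3 + k * 8) → g (3 + k * 8) ≡ false
  vanish-3mod8 k q≤ v = trans (cong g (sym (eq k))) (vanish-next (λ i → g (y + i * 2)) k 0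
    (vanish-stride g 2 y (k * 2) (shrink (s≤s z≤n) v) (eq k))
    (trans (cong g (eq′ k)) (trans (odd-eq (u * 2) (≤-trans (≤-witness (1 + k * 8) (le k)) q≤))
      (tri-stride₀ g 2 (tri-+2 g) y u))))
    where
    u = suc (k * 2)
    y = suc (u * 2)
    eq : ∀ k → suc (suc (k * 2) * 2) + k * 2 * 2 ≡ 3 + k * 8
    eq = solve-∀
    eq′ : ∀ k → suc (suc (k * 2) * 2) + suc (k * 2) * 2 ≡ suc (suc (k * 2) * 2 * 2)
    eq′ = solve-∀
    le : ∀ k → suc (suc (k * 2) * 2 * 2) + (1 + k * 8) ≡ (3 + k * 8) * 2
    le = solve-∀

  vanish-4mod16 : ∀ k → (4 + k * 16) * 2 ≤ M → Vanishes g 1 (4 + k * 16) → g (4 + k * 16) ≡ false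
  vanish-4mod16 k q≤ v = trans (cong g (sym (eq k))) (vanish-next (λ i → g (y + i * 4)) k 0
    (vanish-stride g 4 y (k * 2) (shrink (s≤s z≤n) v) (eq k))
    (trans (cong g (eq′ k)) (trans (even-eq y (≤-trans (≤-witness (k * 16) (le k)) q≤))
      (tri-stride₀ g 4 (tri-+4 g) y u))))
    where
    u = suc (k * 2)
    y = u * 4
    eq : ∀ k → suc (k * 2) * 4 + k * 2 * 4 ≡ 4 + k * 16
    eq = solve-∀
    eq′ : ∀ k → suc (k * 2) * 4 + suc (k * 2) * 4 ≡ suc (k * 2) * 4 * 2
    eq′ = solve-∀
    le : ∀ k → suc (k * 2) * 4 * 2 + k * 16 ≡ (4 + k * 16) * 2
    le = solve-∀

  -- Here a single equation does not suffice: with 8k = 8 + 16a, the equation for 8k + 3 gives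
  -- g (8k + 2) = 0, and then the one for 8k + 4 gives g (8k) = 0 because k is odd.
  vanish-8mod16 : ∀ a → (8 + a * 16) * 2 ≤ M → Vanishes g 1 (8 + a * 16) → g (8 + a * 16) ≡ false
  vanish-8mod16 a q≤ v = xor-cancelʳ (g (8 + a * 16)) (g (k * 8 + 4))
      (trans (sym even-row) (trans (cong (_xor tri g (k * 4) (k * 4 + 4)) g₂) right))
    where
    k = suc (a * 2)
    k8 : k * 8 ≡ 8 + a * 16
    k8 = eq a
      where
      eq : ∀ a → suc (a * 2) * 8 ≡ 8 + a * 16
      eq = solve-∀
    v′ : ∀ {l} → 1 ≤ l → Vanishes g l (k * 8)
    v′ p i l u = v i (≤-trans p l) (subst (i <_) k8 u)
    window : ∀ j → tri g (k * 4) (k * 4 + j) ≡ tri (λ i → g (k * 4 + j + i * 4)) k 0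
    window j = tri-stride₀ g 4 (tri-+4 g) (k * 4 + j) k
    below : ∀ j i → j < 4 → i < k → j + i * 4 < k * 4
    below j i j<4 i<k = <-≤-trans (+-monoˡ-< (i * 4) j<4) (*-monoˡ-≤ 4 i<k)
    single : ∀ j → j < 4 → tri g (k * 4) (k * 4 + j) ≡ g (k * 8 + j)
    single j j<4 = trans (window j) (trans
      (tri-vanish _ k 0 λ i _ i<k → v′ (subst (1 ≤_) (sym (+-assoc (k * 4) j (i * 4))) (s≤s z≤n)) _ ≤-refl
        (subst₂ _<_ (sym (+-assoc (k * 4) j (i * 4))) (dbl k) (+-monoʳ-< (k * 4) (below j i j<4 i<k))))
      (cong g (eq k j)))
      where
      dbl : ∀ k → k * 4 + k * 4 ≡ k * 8
      dbl = solve-∀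
      eq : ∀ k j → k * 4 + j + k * 4 ≡ k * 8 + j
      eq = solve-∀
    right : tri g (k * 4) (k * 4 + 4) ≡ g (8 + a * 16) xor g (k * 8 + 4)
    right = trans (window 4) (trans
      (tri-vanish-odd _ a 0 λ i _ i<2a → v′ (subst (1 ≤_) (sym (+-assoc (k * 4) 4 (i * 4))) (s≤s z≤n)) _ ≤-refl
        (subst₂ _<_ (sym (+-assoc (k * 4) 4 (i * 4))) (dbl a)
          (+-monoʳ-< (k * 4) (+-monoʳ-< 4 (*-monoˡ-< 4 i<2a)))))
      (cong₂ _xor_ (cong g (eq a)) (cong g (eq′ a))))
      where
      dbl : ∀ a → suc (a * 2) * 4 + (4 + a * 2 * 4) ≡ suc (a * 2) * 8
      dbl = solve-∀
      eq : ∀ a → suc (a * 2) * 4 + 4 + a * 2 * 4 ≡ 8 + a * 16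
      eq = solve-∀
      eq′ : ∀ a → suc (a * 2) * 4 + 4 + suc (a * 2) * 4 ≡ suc (a * 2) * 8 + 4
      eq′ = solve-∀
    bound : ∀ j → j ≤ 8 → k * 8 + j ≤ M
    bound j j≤8 = ≤-trans (+-monoʳ-≤ (k * 8) j≤8) (≤-trans (≤-witness (a * 16) (eq a)) q≤)
      where
      eq : ∀ a → suc (a * 2) * 8 + 8 + a * 16 ≡ (8 + a * 16) * 2
      eq = solve-∀
    g₂ : tri g (k * 4) (k * 4 + 2) ≡ false
    g₂ = xor-cancelʳ _ (g (k * 8 + 3)) (trans (cong g (eq k)) (trans
      (odd-eq (suc (k * 4)) (subst (_≤ M) (eq k) (bound 3 (s≤s (s≤s (s≤s z≤n))))))
      (trans (cong (tri g (suc (k * 4))) (eq′ k)) (cong (tri g (k * 4) (k * 4 + 2) xor_)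
        (trans (cong (tri g (k * 4)) (eq″ k)) (single 3 ≤-refl))))))
      where
      eq : ∀ k → k * 8 + 3 ≡ suc (suc (k * 4) * 2)
      eq = solve-∀
      eq′ : ∀ k → suc (suc (k * 4)) ≡ k * 4 + 2
      eq′ = solve-∀
      eq″ : ∀ k → suc (k * 4 + 2) ≡ k * 4 + 3
      eq″ = solve-∀
    even-row : tri g (k * 4) (k * 4 + 2) xor tri g (k * 4) (k * 4 + 4) ≡ g (k * 8 + 4)
    even-row = sym (trans (cong g (eq k)) (trans
      (even-eq (2 + k * 4) (subst (_≤ M) (eq k) (bound 4 (s≤s (s≤s (s≤s (s≤s z≤n)))))))
      (trans (tri-+2 g (k * 4) (2 + k * 4)) (cong₂ (λ p q → tri g (k * 4) p xor tri g (k * 4) q)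
        (+-comm 2 (k * 4)) (+-comm 4 (k * 4))))))
      where
      eq : ∀ k → k * 8 + 4 ≡ (2 + k * 4) * 2
      eq = solve-∀

  vanish-lower-half : (∀ t → suc t * 8 ≤ M → g (suc (slot t)) ≡ false) →
    ∀ q → 1 ≤ q → q * 2 ≤ M → g q ≡ false
  vanish-lower-half free = <-rec _ λ q ih 1≤q q≤ →
    by-residue q 1≤q q≤ λ i 1≤i i<q → ih i<q 1≤i (≤-trans (*-monoˡ-≤ 2 (<⇒≤ i<q)) q≤)
    where
    Goal : ℕ → Set
    Goal q = 1 ≤ q → q * 2 ≤ M → Vanishes g 1 q → g q ≡ false

    via : ∀ {q q′} → q′ ≡ q → (q′ * 2 ≤ M → Vanishes g 1 q′ → g q′ ≡ false) → Goal q
    via refl h _ = h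

    via-slot : ∀ {q} a j c → suc (a * 4 + j) * 8 + c ≡ suc (a * 16 + slot j) * 2 →
      suc (a * 16 + slot j) ≡ q → Goal q
    via-slot a j c le refl _ q≤ _ = trans (cong (g ∘ suc) (sym (slot-block a j)))
      (free (a * 4 + j) (≤-trans (≤-witness c le) q≤))

    by-residue : ∀ q → Goal q
    by-residue q with q divMod 4
    ... | result k 1F refl = λ _ → vanish-1mod4 k
    ... | result k 2F refl = λ _ → vanish-2mod4 k
    ... | result k 3F refl with k divMod 4
    ...   | result a 0F refl = via (eq a) (vanish-3mod8 (a * 2))
      where
      eq : ∀ a → 3 + a * 2 * 8 ≡ 3 + (0 + a * 4) * 4
      eq = solve-∀
    ...   | result a 1F refl = via-slot a 0 6 (le a) (eq a)
      where
      le : ∀ a → suc (a * 4 + 0) * 8 + 6 ≡ suc (a * 16 + 6) * 2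
      le = solve-∀
      eq : ∀ a → suc (a * 16 + 6) ≡ 3 + (1 + a * 4) * 4
      eq = solve-∀
    ...   | result a 2F refl = via (eq a) (vanish-3mod8 (1 + a * 2))
      where
      eq : ∀ a → 3 + (1 + a * 2) * 8 ≡ 3 + (2 + a * 4) * 4
      eq = solve-∀
    ...   | result a 3F refl = via-slot a 2 6 (le a) (eq a)
      where
      le : ∀ a → suc (a * 4 + 2) * 8 + 6 ≡ suc (a * 16 + 14) * 2
      le = solve-∀
      eq : ∀ a → suc (a * 16 + 14) ≡ 3 + (3 + a * 4) * 4
      eq = solve-∀
    by-residue q | result k 0F refl with k divMod 4
    ...   | result zero 0F refl = λ ()
    ...   | result (suc a) 0F refl = via-slot a 3 0 (le a) (eq a)
      where
      le : ∀ a → suc (a * 4 + 3) * 8 + 0 ≡ suc (a * 16 + 15) * 2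
      le = solve-∀
      eq : ∀ a → suc (a * 16 + 15) ≡ (0 + suc a * 4) * 4
      eq = solve-∀
    ...   | result a 1F refl = via (eq a) (vanish-4mod16 a)
      where
      eq : ∀ a → 4 + a * 16 ≡ (1 + a * 4) * 4
      eq = solve-∀
    ...   | result a 2F refl = via (eq a) (vanish-8mod16 a)
      where
      eq : ∀ a → 8 + a * 16 ≡ (2 + a * 4) * 4
      eq = solve-∀
    ...   | result a 3F refl = via-slot a 1 8 (le a) (eq a)
      where
      le : ∀ a → suc (a * 4 + 1) * 8 + 8 ≡ suc (a * 16 + 11) * 2
      le = solve-∀
      eq : ∀ a → suc (a * 16 + 11) ≡ (3 + a * 4) * 4
      eq = solve-∀

-- The entry tri b x y lies at distances x, y and z = d ∸ x ∸ y from the three sides of the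
-- triangle of size d + 1; the two symmetries generate all permutations of (x, y, z).
record IsDihedral (d : ℕ) (b : ℕ → Bool) : Set where
  field
    swap : ∀ x y z → x + y + z ≡ d → tri b x y ≡ tri b y x
    flip : ∀ x y z → x + y + z ≡ d → tri b x y ≡ tri b x z

  corner : 1 ≤ d → b 0 ≡ false
  corner (s≤s {n = n} z≤n) = xor-cancelʳ (b 0) (b 1) (swap 0 1 n refl)

  axis : ∀ x y → suc x + y + y ≡ d → tri b (suc x) y ≡ false
  axis x y e = trans (cong (_xor tri b x (suc y)) (flip x y (suc y) (trans (eq x y) e)))
                     (xor-same (tri b x (suc y)))
    where
    eq : ∀ x y → x + y + suc y ≡ suc x + y + y
    eq = solve-∀

-- Regularity modulo 4 in terms of the triangle: the inner degrees are even, and modulo 2 half the degree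
-- of V_{j+2} is the sum of the three entries below, where ⌊_/2⌋ picks the middle of a row.
IsBalanced : ℕ → (ℕ → Bool) → Set
IsBalanced d b = ∀ j l → suc (j + l) ≡ d →
  tri b 1 j ≡ tri b l ⌊ suc j /2⌋ xor tri b j ⌊ suc l /2⌋

⌊n*2/2⌋≡n : ∀ n → ⌊ n * 2 /2⌋ ≡ n
⌊n*2/2⌋≡n zero    = refl
⌊n*2/2⌋≡n (suc n) = cong suc (⌊n*2/2⌋≡n n)

⌊1+n*2/2⌋≡n : ∀ n → ⌊ suc (n * 2) /2⌋ ≡ n
⌊1+n*2/2⌋≡n zero    = refl
⌊1+n*2/2⌋≡n (suc n) = cong suc (⌊1+n*2/2⌋≡n n)

halve : (ℕ → Bool) → ℕ → Bool
halve b zero    = false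
halve b (suc y) = b (suc (y * 2))

module Halving (e : ℕ) (b : ℕ → Bool)
  (dih : IsDihedral (suc (e * 2)) b) (bal : IsBalanced (suc (e * 2)) b) where
  open IsDihedral dih

  double : ∀ {m} → m ≡ e → suc (m * 2) ≡ suc (e * 2)
  double = cong (λ m → suc (m * 2))

  odd-odd : ∀ x y z → x + y + suc z ≡ e → tri b (suc (x * 2)) (suc (y * 2)) ≡ false
  odd-odd zero y z eq = trans (bal (suc (y * 2)) (suc (z * 2)) (trans (eq₁ y z) (double eq)))
    (cong₂ _xor_
      (trans (cong (tri b (suc (z * 2)) ∘ suc) (⌊n*2/2⌋≡n y)) (axis (z * 2) (suc y) (trans (eq₂ y z) (double eq))))
      (trans (cong (tri b (suc (y * 2)) ∘ suc) (⌊n*2/2⌋≡n z)) (axis (y * 2) (suc z) (trans (eq₃ y z) (double eq)))))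
    where
    eq₁ : ∀ y z → suc (suc (y * 2) + suc (z * 2)) ≡ suc ((0 + y + suc z) * 2)
    eq₁ = solve-∀
    eq₂ : ∀ y z → suc (z * 2) + suc y + suc y ≡ suc ((0 + y + suc z) * 2)
    eq₂ = solve-∀
    eq₃ : ∀ y z → suc (y * 2) + suc z + suc z ≡ suc ((0 + y + suc z) * 2)
    eq₃ = solve-∀
  odd-odd (suc x) y z eq = trans (tri-+2 b (suc (x * 2)) (suc (y * 2))) (cong₂ _xor_
    (odd-odd x y (suc z) (trans (eq₁ x y z) eq)) (odd-odd x (suc y) z (trans (eq₂ x y z) eq)))
    where
    eq₁ : ∀ x y z → x + y + suc (suc z) ≡ suc x + y + suc z
    eq₁ = solve-∀
    eq₂ : ∀ x y z → x + suc y + suc z ≡ suc x + y + suc z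
    eq₂ = solve-∀

  skip-row : ∀ x y z → x + y + suc z ≡ e →
    tri b (suc (suc (x * 2))) (suc (y * 2)) ≡ tri b (suc (x * 2)) (suc (suc (y * 2)))
  skip-row x y z eq = cong (_xor tri b (suc (x * 2)) (suc (suc (y * 2)))) (odd-odd x y z eq)

  halve-y : ∀ x y → tri (halve b) x (suc y) ≡ tri b (x * 2) (suc (y * 2))
  halve-y zero    y = refl
  halve-y (suc x) y = trans (cong₂ _xor_ (halve-y x y) (halve-y x (suc y)))
                            (sym (tri-+2 b (x * 2) (suc (y * 2))))

  halve-z : ∀ x y z → x + y + z ≡ e → tri (halve b) x y ≡ tri b (x * 2) (y * 2)
  halve-z x (suc y) z eq = trans (halve-y x y) (xor-false⇒≡ _ _ (odd-y x eq))
    where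
    odd-y : ∀ x → x + suc y + z ≡ e → tri b (suc (x * 2)) (suc (y * 2)) ≡ false
    odd-y x eq = odd-odd x y z (trans (eq′ x y z) eq)
      where
      eq′ : ∀ x y z → x + y + suc z ≡ x + suc y + z
      eq′ = solve-∀
  halve-z zero    zero z eq = sym (corner (s≤s z≤n))
  halve-z (suc x) zero z eq = trans (cong₂ _xor_ (halve-z x 0 (suc z) (trans (+-suc (x + 0) z) eq)) (halve-y x 0))
    (sym (trans (cong (tri b (suc (x * 2)) 0 xor_) (odd-odd x 0 z (trans (+-suc (x + 0) z) eq)))
                (xor-identityʳ _)))

  halve-x : ∀ x y z → x + y + z ≡ e → tri (halve b) (suc x) y ≡ tri b (suc (x * 2)) (y * 2)
  halve-x x y z eq = cong₂ _xor_ (halve-z x y z eq) (halve-y x y)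

  halve-dihedral : IsDihedral (suc e) (halve b)
  halve-dihedral = record { swap = swap′ ; flip = flip′ }
    where
    swap-suc : ∀ x y z → x + y + z ≡ e → tri (halve b) (suc x) y ≡ tri (halve b) y (suc x)
    swap-suc x y z eq = trans (halve-x x y z eq) (trans
      (swap (suc (x * 2)) (y * 2) (z * 2) (trans (eq′ x y z) (double eq)))
      (sym (halve-y y x)))
      where
      eq′ : ∀ x y z → suc (x * 2) + y * 2 + z * 2 ≡ suc ((x + y + z) * 2)
      eq′ = solve-∀
    swap′ : ∀ x y z → x + y + z ≡ suc e → tri (halve b) x y ≡ tri (halve b) y x
    swap′ (suc x) y       z eq = swap-suc x y z (suc-injective eq)
    swap′ zero    zero    z eq = refl
    swap′ zero    (suc y) z eq = sym (swap-suc y 0 z (trans (cong (_+ z) (+-identityʳ y)) (suc-injective eq)))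

    flip-suc : ∀ x y z → x + z + y ≡ e → tri (halve b) x (suc y) ≡ tri (halve b) x z
    flip-suc x y z eq = trans (halve-y x y) (trans
      (flip (x * 2) (suc (y * 2)) (z * 2) (trans (eq′ x y z) (double eq)))
      (sym (halve-z x z y eq)))
      where
      eq′ : ∀ x y z → x * 2 + suc (y * 2) + z * 2 ≡ suc ((x + z + y) * 2)
      eq′ = solve-∀
    flip′ : ∀ x y z → x + y + z ≡ suc e → tri (halve b) x y ≡ tri (halve b) x z
    flip′ x (suc y) z       eq = flip-suc x y z (suc-injective (trans (eq′ x y z) eq))
      where
      eq′ : ∀ x y z → suc (x + z + y) ≡ x + suc y + z
      eq′ = solve-∀
    flip′ x zero    zero    eq = refl
    flip′ x zero    (suc z) eq = sym (flip-suc x z 0 (suc-injective (trans (sym (+-suc (x + 0) z)) eq)))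

  halve-middle : ∀ j l → j + l ≡ e → tri (halve b) l ⌊ suc j /2⌋ ≡ tri b (l * 2) j
  halve-middle j l eq with j divMod 2
  ... | result i 0F refl = trans (cong (tri (halve b) l) (⌊1+n*2/2⌋≡n i))
    (halve-z l i i (trans (eq′ l i) eq))
    where
    eq′ : ∀ l i → l + i + i ≡ i * 2 + l
    eq′ = solve-∀
  ... | result i 1F refl = trans (cong (tri (halve b) l ∘ suc) (⌊n*2/2⌋≡n i)) (halve-y l i)

  halve-balanced : IsBalanced (suc e) (halve b)
  halve-balanced j l eq = begin
    tri (halve b) 1 j
      ≡⟨ halve-x 0 j l eq′ ⟩
    tri b 1 (j * 2)
      ≡⟨ bal (j * 2) (l * 2) (cong suc (trans (sym (*-distribʳ-+ 2 j l)) (cong (_* 2) eq′))) ⟩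
    tri b (l * 2) ⌊ suc (j * 2) /2⌋ xor tri b (j * 2) ⌊ suc (l * 2) /2⌋
      ≡⟨ cong₂ (λ p q → tri b (l * 2) p xor tri b (j * 2) q) (⌊1+n*2/2⌋≡n j) (⌊1+n*2/2⌋≡n l) ⟩
    tri b (l * 2) j xor tri b (j * 2) l
      ≡⟨ cong₂ _xor_ (halve-middle j l eq′) (halve-middle l j (trans (+-comm l j) eq′)) ⟨
    tri (halve b) l ⌊ suc j /2⌋ xor tri (halve b) j ⌊ suc l /2⌋ ∎
    where
    open ≡-Reasoning
    eq′ = suc-injective eq

  unhalve : (∀ y → y ≤ suc e → halve b y ≡ false) → ∀ y → y ≤ suc (e * 2) → b y ≡ false
  unhalve v y y≤ with y divMod 2
  ... | result i 0F refl = trans (sym (halve-z 0 i _ (m+[n∸m]≡n i≤e))) (v i (≤-trans i≤e (n≤1+n e)))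
    where
    i≤e : i ≤ e
    i≤e = subst₂ _≤_ (⌊n*2/2⌋≡n i) (⌊1+n*2/2⌋≡n e) (⌊n/2⌋-mono y≤)
  ... | result i 1F refl = v (suc i) (s≤s (*-cancelʳ-≤ i e 2 (≤-pred y≤)))
  
module EvenSize (M : ℕ) (b : ℕ → Bool)
  (dih : IsDihedral (suc M * 2) b) (bal : IsBalanced (suc M * 2) b) where
  open IsDihedral dih

  g : ℕ → Bool
  g q = tri b 1 (q * 2)

  at-double : ∀ {m n} → m ≡ suc n * 2 → n ≡ M → m ≡ suc M * 2
  at-double e refl = e

  tri-g : ∀ x y → tri g x y ≡ tri b (suc (x * 2)) (y * 2)
  tri-g zero    y = refl
  tri-g (suc x) y = trans (cong₂ _xor_ (tri-g x y) (tri-g x (suc y)))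
                          (sym (tri-+2 b (suc (x * 2)) (y * 2)))

  balanced-even : ∀ q r → q + r ≡ M →
    g q ≡ tri b (suc (r * 2)) q xor tri b (q * 2) (suc r)
  balanced-even q r eq = trans (bal (q * 2) (suc (r * 2)) (at-double (eq′ q r) eq))
    (cong₂ (λ i j → tri b (suc (r * 2)) i xor tri b (q * 2) (suc j)) (⌊1+n*2/2⌋≡n q) (⌊n*2/2⌋≡n r))
    where
    eq′ : ∀ q r → suc (q * 2 + suc (r * 2)) ≡ suc (q + r) * 2
    eq′ = solve-∀

  centre : b (suc M) ≡ false
  centre = xor-cancelʳ (b (suc M)) (tri b (suc (M * 2)) 0) (begin
    tri b (suc (M * 2)) 0                   ≡⟨ swap (suc (M * 2)) 0 1 (eq₁ M) ⟩
    b (suc (M * 2))                         ≡⟨ flip 0 (suc (M * 2)) 1 (eq₂ M) ⟩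
    b 1                                     ≡⟨ cong (_xor b 1) (corner (s≤s z≤n)) ⟨
    tri b 1 0                               ≡⟨ balanced-even 0 M refl ⟩
    tri b (suc (M * 2)) 0 xor b (suc M)     ≡⟨ xor-comm _ (b (suc M)) ⟩
    b (suc M) xor tri b (suc (M * 2)) 0     ∎)
    where
    open ≡-Reasoning
    eq₁ : ∀ M → suc (M * 2) + 0 + 1 ≡ suc M * 2
    eq₁ = solve-∀
    eq₂ : ∀ M → 0 + suc (M * 2) + 1 ≡ suc M * 2
    eq₂ = solve-∀

  g-middle : ∀ q r → suc q + r ≡ M → g (suc q) ≡ tri b (suc (r * 2)) (suc q)
  g-middle q r eq = trans (balanced-even (suc q) r eq)
    (trans (cong (tri b (suc (r * 2)) (suc q) xor_) (axis (suc (q * 2)) (suc r) (at-double (eq′ q r) eq)))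
           (xor-identityʳ _))
    where
    eq′ : ∀ q r → suc (suc (q * 2)) + suc r + suc r ≡ suc (suc q + r) * 2
    eq′ = solve-∀

  even-eq : ∀ i → i * 2 ≤ M → g (i * 2) ≡ tri g i i
  even-eq zero    _  = refl
  even-eq (suc i) i≤ = begin
    g (suc i * 2)                              ≡⟨ g-middle (suc (i * 2)) r eq ⟩
    tri b (suc (r * 2)) (suc i * 2)            ≡⟨ swap (suc (r * 2)) (suc i * 2) (suc (suc i * 2)) (at-double (eq₁ i r) eq) ⟩
    tri b (suc i * 2) (suc (r * 2))            ≡⟨ flip (suc i * 2) (suc (r * 2)) (suc (suc i * 2)) (at-double (eq₂ i r) eq) ⟩
    tri b (suc i * 2) (suc (suc i * 2))        ≡⟨ swap (suc i * 2) (suc (suc i * 2)) (suc (r * 2)) (at-double (eq₃ i r) eq) ⟩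
    tri b (suc (suc i * 2)) (suc i * 2)        ≡⟨ tri-g (suc i) (suc i) ⟨
    tri g (suc i) (suc i)                      ∎
    where
    open ≡-Reasoning
    r = M ∸ suc i * 2
    eq : suc i * 2 + r ≡ M
    eq = m+[n∸m]≡n i≤
    eq₁ : ∀ i r → suc (r * 2) + suc i * 2 + suc (suc i * 2) ≡ suc (suc i * 2 + r) * 2
    eq₁ = solve-∀
    eq₂ : ∀ i r → suc i * 2 + suc (r * 2) + suc (suc i * 2) ≡ suc (suc i * 2 + r) * 2
    eq₂ = solve-∀
    eq₃ : ∀ i r → suc i * 2 + suc (suc i * 2) + suc (r * 2) ≡ suc (suc i * 2 + r) * 2
    eq₃ = solve-∀

  odd-eq : ∀ i → suc (i * 2) ≤ M → g (suc (i * 2)) ≡ tri g i (suc i)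
  odd-eq i i≤ = begin
    g (suc (i * 2))                          ≡⟨ g-middle (i * 2) r eq ⟩
    tri b (suc (r * 2)) (suc (i * 2))        ≡⟨ swap (suc (r * 2)) (suc (i * 2)) (suc i * 2) (at-double (eq₁ i r) eq) ⟩
    tri b (suc (i * 2)) (suc (r * 2))        ≡⟨ flip (suc (i * 2)) (suc (r * 2)) (suc i * 2) (at-double (eq₂ i r) eq) ⟩
    tri b (suc (i * 2)) (suc i * 2)          ≡⟨ tri-g i (suc i) ⟨
    tri g i (suc i)                          ∎
    where
    open ≡-Reasoning
    r = M ∸ suc (i * 2)
    eq : suc (i * 2) + r ≡ M
    eq = m+[n∸m]≡n i≤
    eq₁ : ∀ i r → suc (r * 2) + suc (i * 2) + suc i * 2 ≡ suc (suc (i * 2) + r) * 2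
    eq₁ = solve-∀
    eq₂ : ∀ i r → suc (i * 2) + suc (r * 2) + suc i * 2 ≡ suc (suc (i * 2) + r) * 2
    eq₂ = solve-∀

  g-reflect : ∀ q r → q + r ≡ M → tri b 1 (suc (q * 2)) ≡ g r
  g-reflect q r eq = flip 1 (suc (q * 2)) (r * 2) (at-double (eq′ q r) eq)
    where
    eq′ : ∀ q r → 1 + suc (q * 2) + r * 2 ≡ suc (q + r) * 2
    eq′ = solve-∀

  g-second : ∀ s r → s + suc r ≡ M → tri g s 1 ≡ g (suc r) xor g (suc s)
  g-second s r eq = begin
    tri g s 1                                  ≡⟨ tri-g s 1 ⟩
    tri b (suc (s * 2)) 2                      ≡⟨ swap (suc (s * 2)) 2 (suc (r * 2)) (at-double (eq′ s r) eq) ⟩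
    tri b 1 (suc (s * 2)) xor g (suc s)        ≡⟨ cong (_xor g (suc s)) (g-reflect s (suc r) eq) ⟩
    g (suc r) xor g (suc s)                    ∎
    where
    open ≡-Reasoning
    eq′ : ∀ s r → suc (s * 2) + 2 + suc (r * 2) ≡ suc (s + suc r) * 2
    eq′ = solve-∀

  module _ (lower : ∀ q → 1 ≤ q → q * 2 ≤ M → g q ≡ false) where

    g-vanish : ∀ q → 1 ≤ q → q ≤ M → g q ≡ false
    g-vanish (suc r) 1≤q q≤M with suc r * 2 ≤? M
    ... | yes q≤ = lower (suc r) 1≤q q≤
    ... | no q≰ = xor-cancelʳ (g (suc r)) (g (suc s))
      (trans (sym (tri-vanish g s 1 vanishes)) (g-second s r (m∸n+n≡m q≤M)))
      where
      s = M ∸ suc r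
      s≤r : s ≤ r
      s≤r = +-cancelʳ-≤ (suc r) s r (subst₂ _≤_ (sym (m∸n+n≡m q≤M)) (eq r) (≤-pred (≰⇒> q≰)))
        where
        eq : ∀ r → suc (r * 2) ≡ r + suc r
        eq = solve-∀
      vanishes : Vanishes g 1 (suc s)
      vanishes i 1≤i (s≤s i≤s) = lower i 1≤i (subst (i * 2 ≤_) (m∸n+n≡m q≤M)
        (≤-trans (≤-reflexive (eq i)) (+-mono-≤ i≤s (≤-trans i≤s (≤-trans s≤r (n≤1+n r))))))
        where
        eq : ∀ i → i * 2 ≡ i + i
        eq = solve-∀

    b-step : ∀ y → suc y ≤ suc (M * 2) → 1 ≤ y → tri b 1 y ≡ false
    b-step y y≤ 1≤y with y divMod 2
    ... | result (suc q) 0F refl = g-vanish (suc q) (s≤s z≤n) (*-cancelʳ-≤ (suc q) M 2 (≤-pred y≤))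
    ... | result q 1F refl = trans (g-reflect q (M ∸ q) (m+[n∸m]≡n (<⇒≤ q<M)))
      (g-vanish (M ∸ q) (m<n⇒0<n∸m q<M) (m∸n≤m M q))
      where
      q<M : q < M
      q<M = *-cancelʳ-< 2 q M (≤-pred y≤)

    b-constant : ∀ y → suc y ≤ suc (M * 2) → b (suc y) ≡ b 1
    b-constant zero    _  = refl
    b-constant (suc y) y≤ = trans (sym (xor-false⇒≡ _ _ (b-step (suc y) y≤ (s≤s z≤n))))
                                  (b-constant y (<⇒≤ y≤))

    b-vanish : ∀ y → y ≤ suc M * 2 → b y ≡ false
    b-vanish zero    _ = corner (s≤s z≤n)
    b-vanish (suc y) y≤ with suc y ≤? suc (M * 2)
    ... | yes y≤′ = trans (b-constant y y≤′)
      (trans (sym (b-constant M (s≤s (m≤m*n M 2)))) centre)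
    ... | no y≰ = trans (cong b (≤-antisym y≤ (≰⇒> y≰)))
      (trans (flip 0 (suc M * 2) 0 (+-identityʳ _)) (corner (s≤s z≤n)))

-- The column is shifted by one because, away from column 0, halve doubles both coordinates.
Point : Set
Point = ℕ × ℕ

value : (ℕ → Bool) → Point → Bool
value b (x , y) = tri b x (suc y)

Determining : ℕ → List Point → Set
Determining d ps = ∀ b → IsDihedral d b → IsBalanced d b →
  All (λ p → value b p ≡ false) ps → ∀ y → y ≤ d → b y ≡ false

determining-odd : ∀ e ps → Determining (suc e) ps →
  Determining (suc (e * 2)) (map (λ (x , y) → x * 2 , y * 2) ps)
determining-odd e ps det b dih bal zeros = unhalve (det (halve b) halve-dihedral halve-balanced
  (All.map (λ {(x , y)} z → trans (halve-y x y) z) (map⁻ zeros)))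
  where open Halving e b dih bal

determining-even : ∀ M → Determining (suc M * 2) (applyUpTo (λ t → 1 , suc (slot t * 2)) (M / 8))
determining-even M b dih bal zeros = b-vanish
  (vanish-lower-half g M even-eq odd-eq λ t t≤ → applyUpTo⁻ _ (M / 8) zeros
    (subst (_≤ M / 8) (m*n/n≡m (suc t) 8) (/-monoˡ-≤ 8 t≤)))
  where open EvenSize M b dih bal

determining-1 : Determining 1 []
determining-1 b dih _ _ zero          _ = IsDihedral.corner dih (s≤s z≤n)
determining-1 b dih _ _ (suc zero)    _ =
  trans (IsDihedral.flip dih 0 1 0 refl) (IsDihedral.corner dih (s≤s z≤n))
determining-1 b dih _ _ (suc (suc y)) (s≤s ())

determining : ∀ d → 1 ≤ d → ∃[ ps ] Determining d ps × length ps * 30 ≤ d * 2 + 30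
determining = <-rec _ step
  where
  step : ∀ d → (∀ {d′} → d′ < d → 1 ≤ d′ → ∃[ ps ] Determining d′ ps × length ps * 30 ≤ d′ * 2 + 30) →
    1 ≤ d → ∃[ ps ] Determining d ps × length ps * 30 ≤ d * 2 + 30
  step d ih 1≤d with d divMod 2
  ... | result (suc M) 0F refl = _ , determining-even M , (begin
    length (applyUpTo (λ t → 1 , suc (slot t * 2)) (M / 8)) * 30
      ≡⟨ cong (_* 30) (length-applyUpTo _ (M / 8)) ⟩
    M / 8 * 30           ≤⟨ *-monoʳ-≤ (M / 8) {30} {32} (m≤m+n 30 2) ⟩
    M / 8 * 32           ≡⟨ *-assoc (M / 8) 8 4 ⟨
    M / 8 * 8 * 4        ≤⟨ *-monoˡ-≤ 4 (m/n*n≤m M 8) ⟩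
    M * 4                ≤⟨ ≤-witness 34 (eq M) ⟩
    suc M * 2 * 2 + 30   ∎)
    where
    open ≤-Reasoning
    eq : ∀ M → M * 4 + 34 ≡ suc M * 2 * 2 + 30
    eq = solve-∀
  ... | result zero 1F refl = [] , determining-1 , z≤n
  ... | result (suc e) 1F refl with ih (s≤s (s≤s (s≤s (m≤m*n e 2)))) (s≤s z≤n)
  ...   | ps , det , len = _ , determining-odd (suc e) ps det , (begin
    length (map _ ps) * 30          ≡⟨ cong (_* 30) (length-map _ ps) ⟩
    length ps * 30                  ≤⟨ len ⟩
    suc (suc e) * 2 + 30            ≤⟨ ≤-witness (2 + e * 2) (eq e) ⟩
    suc (suc e * 2) * 2 + 30        ∎)
    where
    open ≤-Reasoning
    eq : ∀ e → suc (suc e) * 2 + 30 + (2 + e * 2) ≡ suc (suc e * 2) * 2 + 30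
    eq = solve-∀

determining-odd-short : ∀ e → ∃[ ps ] Determining (suc (e * 2)) ps × length ps * 30 ≤ suc (e * 2) + 31
determining-odd-short e with determining (suc e) (s≤s z≤n)
... | ps , det , len = _ , determining-odd e ps det ,
  subst₂ _≤_ (sym (cong (_* 30) (length-map _ ps))) (eq e) len
  where
  eq : ∀ e → suc e * 2 + 30 ≡ suc (e * 2) + 31
  eq = solve-∀

odd : ℕ → Bool
odd zero    = false
odd (suc n) = not (odd n)

odd-+ : ∀ m n → odd (m + n) ≡ odd m xor odd n
odd-+ zero    n = refl
odd-+ (suc m) n = trans (cong not (odd-+ m n)) (not-distribˡ-xor (odd m) (odd n))

*2%4 : ∀ m → (m * 2) % 4 ≡ (if odd m then 2 else 0)
*2%4 zero          = refl
*2%4 (suc zero)    = refl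
*2%4 (suc (suc m)) = trans (*2%4 m) (cong (if_then 2 else 0) (sym (not-involutive (odd m))))

*2%4-odd : ∀ m n → (m * 2) % 4 ≡ (n * 2) % 4 → odd m ≡ odd n
*2%4-odd m n e = go (odd m) (odd n) (trans (sym (*2%4 m)) (trans e (*2%4 n)))
  where
  go : ∀ p q → (if p then 2 else 0) ≡ (if q then 2 else 0) → p ≡ q
  go false false _ = refl
  go true  true  _ = refl

bit : Bool → ℕ
bit p = if p then 1 else 0

count : (ℕ → Bool) → ℕ → ℕ
count s zero    = 0
count s (suc m) = bit (s 0) + count (s ∘ suc) m

count-cong : ∀ s t m → (∀ k → k < m → s k ≡ t k) → count s m ≡ count t m
count-cong s t zero    e = refl
count-cong s t (suc m) e = cong₂ _+_ (cong bit (e 0 (s≤s z≤n)))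
  (count-cong (s ∘ suc) (t ∘ suc) m λ k k<m → e (suc k) (s≤s k<m))

count-+ : ∀ s m n → count s (m + n) ≡ count s m + count (s ∘ (m +_)) n
count-+ s zero    n = refl
count-+ s (suc m) n = trans (cong (bit (s 0) +_) (count-+ (s ∘ suc) m n))
  (sym (+-assoc (bit (s 0)) (count (s ∘ suc) m) (count (s ∘ (suc m +_)) n)))

count-snoc : ∀ s m → count s (suc m) ≡ bit (s m) + count s m
count-snoc s zero    = refl
count-snoc s (suc m) = trans (cong (bit (s 0) +_) (count-snoc (s ∘ suc) m))
  (swapˡ (bit (s 0)) (bit (s (suc m))) (count (s ∘ suc) m))
  where
  swapˡ : ∀ m n o → m + (n + o) ≡ n + (m + o)
  swapˡ = solve-∀

count-reverse : ∀ s t m → (∀ y z → suc (y + z) ≡ m → s y ≡ t z) → count s m ≡ count t m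
count-reverse s t zero    e = refl
count-reverse s t (suc m) e = trans
  (cong₂ _+_ (cong bit (e 0 m refl)) (count-reverse (s ∘ suc) t m λ y z p → e (suc y) z (cong suc p)))
  (sym (count-snoc t m))

count-palindrome : ∀ s m → (∀ y z → suc (y + z) ≡ m → s y ≡ s z) →
  (∀ y → suc (y + y) ≡ m → s y ≡ false) → count s m ≡ count s ⌊ m /2⌋ * 2
count-palindrome s m pal mid with m divMod 2
... | result k 0F refl = begin
  count s (k * 2)                          ≡⟨ cong (count s) (eq k) ⟩
  count s (k + k)                          ≡⟨ count-+ s k k ⟩
  count s k + count (s ∘ (k +_)) k         ≡⟨ cong (count s k +_) (count-reverse _ s k λ y z p → sym (pal z (k + y) (eq′ y z p))) ⟩
  count s k + count s k                    ≡⟨ eq (count s k) ⟨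
  count s k * 2                            ≡⟨ cong (λ i → count s i * 2) (⌊n*2/2⌋≡n k) ⟨
  count s ⌊ k * 2 /2⌋ * 2                  ∎
  where
  open ≡-Reasoning
  eq : ∀ k → k * 2 ≡ k + k
  eq = solve-∀
  eq″ : ∀ k y z → suc (z + (k + y)) ≡ k + suc (y + z)
  eq″ = solve-∀
  eq′ : ∀ y z → suc (y + z) ≡ k → suc (z + (k + y)) ≡ k * 2
  eq′ y z p = trans (eq″ k y z) (trans (cong (k +_) p) (sym (eq k)))
... | result k 1F refl = begin
  count s (suc (k * 2))                          ≡⟨ cong (count s) (eq k) ⟩
  count s (k + suc k)                            ≡⟨ count-+ s k (suc k) ⟩
  count s k + (bit (s (k + 0)) + count (λ i → s (k + suc i)) k)
    ≡⟨ cong₂ (λ p c → count s k + (bit p + c))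
         (trans (cong s (+-identityʳ k)) (mid k (cong suc (eq₂ k))))
         (count-reverse _ s k λ y z p → sym (pal z (k + suc y) (eq′ y z p))) ⟩
  count s k + count s k                          ≡⟨ eq₂ (count s k) ⟩
  count s k * 2                                  ≡⟨ cong (λ i → count s i * 2) (⌊1+n*2/2⌋≡n k) ⟨
  count s ⌊ suc (k * 2) /2⌋ * 2                  ∎
  where
  open ≡-Reasoning
  eq : ∀ k → suc (k * 2) ≡ k + suc k
  eq = solve-∀
  eq₂ : ∀ k → k + k ≡ k * 2
  eq₂ = solve-∀
  eq″ : ∀ k y z → suc (z + (k + suc y)) ≡ suc (k + suc (y + z))
  eq″ = solve-∀
  eq′ : ∀ y z → suc (y + z) ≡ k → suc (z + (k + suc y)) ≡ suc (k * 2)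
  eq′ y z p = trans (eq″ k y z) (cong suc (trans (cong (k +_) p) (eq₂ k)))

odd-count-bit : ∀ p → odd (bit p) ≡ p
odd-count-bit false = refl
odd-count-bit true  = refl

odd-count-xor : ∀ s m → odd (count (λ y → s y xor s (suc y)) m) ≡ s 0 xor s m
odd-count-xor s zero    = sym (xor-same (s 0))
odd-count-xor s (suc m) = trans (odd-+ (bit (s 0 xor s 1)) _)
  (trans (cong₂ _xor_ (odd-count-bit (s 0 xor s 1)) (odd-count-xor (s ∘ suc) m))
         (xor-telescope (s 0) (s 1) (s (suc m))))

extend : ∀ {n} → (Fin n → Bool) → ℕ → Bool
extend {n} f k with k <? n
... | yes k<n = f (fromℕ< k<n)
... | no _    = false

extend-toℕ : ∀ {n} (f : Fin n → Bool) j → extend f (toℕ j) ≡ f j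
extend-toℕ {n} f j with toℕ j <? n
... | yes p = cong f (fromℕ<-toℕ j p)
... | no ¬p = contradiction (toℕ<n j) ¬p

sum-tabulate : ∀ {n} (f : Fin n → Bool) s → (∀ j → f j ≡ s (toℕ j)) →
  sum (tabulate (bit ∘ f)) ≡ count s n
sum-tabulate {zero}  f s e = refl
sum-tabulate {suc n} f s e = cong₂ _+_ (cong bit (e 0F)) (sum-tabulate (f ∘ fsuc) (s ∘ suc) (e ∘ fsuc))

degree-count : ∀ {n} (M : Matrix n) i → degree M i ≡ count (extend (M i)) n
degree-count {n} M i = trans (cong sum (map-tabulate {n = n} id (bit ∘ M i)))
  (sum-tabulate (M i) (extend (M i)) λ j → sym (extend-toℕ (M i) j))

row : ∀ {n} → Matrix (suc n) → ℕ → Bool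
row M y = extend (M 0F) (suc y)

tri-entry : ∀ {n} (M : Matrix (suc n)) → IsSteinhaus M → ∀ x y i j →
  toℕ i ≡ x → toℕ j ≡ suc (x + y) → tri (row M) x y ≡ M i j
tri-entry M st zero    y 0F j refl ej =
  trans (cong (extend (M 0F)) (sym ej)) (extend-toℕ (M 0F) j)
tri-entry M st@(_ , rec , _) (suc x) y (fsuc i) (fsuc j) ei ej = trans
  (cong₂ _xor_
    (tri-entry M st x y (inject₁ i) (inject₁ j) ei′ (trans (toℕ-inject₁ j) (suc-injective ej)))
    (tri-entry M st x (suc y) (inject₁ i) (fsuc j) ei′ (trans ej (cong suc (sym (+-suc x y))))))
  (sym (rec (fsuc i) (fsuc j) (inject₁ i) (inject₁ j)
    (cong suc (sym (toℕ-inject₁ i))) (cong suc (sym (toℕ-inject₁ j)))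
    (subst₂ _<_ (sym ei) (sym ej) (s≤s (s≤s (m≤m+n x y))))))
  where
  ei′ : toℕ (inject₁ i) ≡ x
  ei′ = trans (toℕ-inject₁ i) (suc-injective ei)

module Triangle (d : ℕ) (M : Matrix (2 + d)) (st : IsSteinhaus M) (ms : IsMultiSymmetric M) where

  b : ℕ → Bool
  b = row M

  at : ∀ k → k ≤ suc d → Fin (2 + d)
  at k k≤ = fromℕ< (s≤s k≤)

  toℕ-at : ∀ k k≤ → toℕ (at k k≤) ≡ k
  toℕ-at k k≤ = toℕ-fromℕ< (s≤s k≤)

  bound : ∀ x y z → x + y + z ≡ d → suc (x + y) ≤ suc d
  bound x y z e = ≤-witness z (cong suc e)

  bound′ : ∀ x y z → x + y + z ≡ d → x ≤ suc d
  bound′ x y z e = ≤-trans (m≤m+n x y) (≤-trans (n≤1+n _) (bound x y z e))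

  flip : ∀ x y z → x + y + z ≡ d → tri b x y ≡ tri b x z
  flip x y z e = begin
    tri b x y   ≡⟨ tri-entry M st x y i j ei ej ⟩
    M i j       ≡⟨ proj₂ ms i j k (subst₂ _<_ (sym ei) (sym ej) (s≤s (m≤m+n x y))) ek+j ⟩
    M i k       ≡⟨ tri-entry M st x z i k ei ek ⟨
    tri b x z   ∎
    where
    open ≡-Reasoning
    swapʳ : ∀ x y z → x + z + y ≡ x + y + z
    swapʳ = solve-∀
    e′ : x + z + y ≡ d
    e′ = trans (swapʳ x y z) e
    i = at x (bound′ x y z e)
    j = at (suc (x + y)) (bound x y z e)
    k = at (suc (x + z)) (bound x z y e′)
    ei = toℕ-at x (bound′ x y z e)
    ej = toℕ-at (suc (x + y)) (bound x y z e)
    ek = toℕ-at (suc (x + z)) (bound x z y e′)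
    eq : ∀ x y z → suc (x + z) + suc (x + y) ≡ 2 + (x + y + z) + x
    eq = solve-∀
    ek+j : toℕ k + toℕ j ≡ 2 + d + toℕ i
    ek+j = trans (cong₂ _+_ ek ej) (trans (eq x y z) (cong₂ (λ p q → 2 + p + q) e (sym ei)))

  transpose : ∀ x y z → x + y + z ≡ d → tri b x y ≡ tri b z y
  transpose x y z e = begin
    tri b x y                       ≡⟨ tri-entry M st x y i j ei ej ⟩
    M i j                           ≡⟨ proj₂ (proj₁ ms i j) ⟩
    M (opposite j) (opposite i)     ≡⟨ tri-entry M st z y (opposite j) (opposite i) eoj eoi ⟨
    tri b z y                       ∎
    where
    open ≡-Reasoning
    i = at x (bound′ x y z e)
    j = at (suc (x + y)) (bound x y z e)
    ei = toℕ-at x (bound′ x y z e)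
    ej = toℕ-at (suc (x + y)) (bound x y z e)
    eoj : toℕ (opposite j) ≡ z
    eoj = trans (opposite-prop j) (trans (cong₂ (λ p q → suc p ∸ q) (sym e) ej) (m+n∸m≡n (x + y) z))
    eq : ∀ x y z → suc (x + y + z) ≡ x + suc (z + y)
    eq = solve-∀
    eoi : toℕ (opposite i) ≡ suc (z + y)
    eoi = trans (opposite-prop i) (trans (cong₂ (λ p q → suc p ∸ q) (sym e) ei)
      (trans (cong (_∸ x) (eq x y z)) (m+n∸m≡n x _)))

  dihedral : IsDihedral d b
  dihedral = record { flip = flip ; swap = λ x y z e →
    trans (flip x y z e) (trans (transpose x z y (trans (eq₁ x y z) e)) (flip y z x (trans (eq₂ x y z) e))) }
    where
    eq₁ : ∀ x y z → x + z + y ≡ x + y + z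
    eq₁ = solve-∀
    eq₂ : ∀ x y z → y + z + x ≡ x + y + z
    eq₂ = solve-∀

  open IsDihedral dihedral using (swap; corner; axis)

  degree-tri : ∀ v w i → toℕ i ≡ v → v + w ≡ suc d →
    degree M i ≡ count (tri b w) v + count (tri b v) w
  degree-tri v w i ei e = begin
    degree M i                            ≡⟨ degree-count M i ⟩
    count s (2 + d)                       ≡⟨ cong (count s) (trans (cong suc (sym e)) (sym (+-suc v w))) ⟩
    count s (v + suc w)                   ≡⟨ count-+ s v (suc w) ⟩
    count s v + (bit (s (v + 0)) + count (λ k → s (v + suc k)) w)
      ≡⟨ cong₂ _+_ (count-cong s (tri b w) v left)
           (cong₂ (λ p q → bit p + q) diagonal (count-cong _ (tri b v) w right)) ⟩
    count (tri b w) v + count (tri b v) w ∎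
    where
    open ≡-Reasoning
    s = extend (M i)
    value-at : ∀ k j → toℕ j ≡ k → s k ≡ M i j
    value-at k j ej = trans (cong s (sym ej)) (extend-toℕ (M i) j)
    diagonal : s (v + 0) ≡ false
    diagonal = trans (value-at (v + 0) i (trans ei (sym (+-identityʳ v)))) (proj₁ st i)
    left : ∀ k → k < v → s k ≡ tri b w k
    left k k<v = trans (value-at k j ej) (trans (proj₂ (proj₂ st) i j)
      (trans (sym (tri-entry M st k y j i ej (trans ei (sym ey))))
        (trans (transpose k y w eq) (flip w y k (trans (rot k y w) eq)))))
      where
      y = v ∸ suc k
      ey : suc (k + y) ≡ v
      ey = m+[n∸m]≡n k<v
      eq : k + y + w ≡ d
      eq = suc-injective (trans (cong (_+ w) ey) e)
      rot : ∀ k y w → w + y + k ≡ k + y + w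
      rot = solve-∀
      k≤ : k ≤ suc d
      k≤ = bound′ k y w eq
      j = at k k≤
      ej = toℕ-at k k≤
    right : ∀ y → y < w → s (v + suc y) ≡ tri b v y
    right y y<w = trans (value-at (v + suc y) j (trans (toℕ-at _ j≤) (sym (+-suc v y))))
      (sym (tri-entry M st v y i j ei (toℕ-at _ j≤)))
      where
      j≤ : suc (v + y) ≤ suc d
      j≤ = subst₂ _≤_ (+-suc v y) e (+-monoʳ-≤ v y<w)
      j = at (suc (v + y)) j≤

  count-row : ∀ x m → x + m ≡ d → count (tri b (suc x)) m ≡ count (tri b (suc x)) ⌊ m /2⌋ * 2
  count-row x m e = count-palindrome (tri b (suc x)) m
    (λ y z p → flip (suc x) y z (trans (eq x y z) (trans (cong (x +_) p) e)))
    (λ y p → axis x y (trans (eq x y y) (trans (cong (x +_) p) e)))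
    where
    eq : ∀ x y z → suc x + y + z ≡ x + suc (y + z)
    eq = solve-∀

  degree-even : ∀ j l i → toℕ i ≡ suc j → suc (j + l) ≡ d → degree M i ≡
    (count (tri b (suc l)) ⌊ suc j /2⌋ + count (tri b (suc j)) ⌊ suc l /2⌋) * 2
  degree-even j l i ei e = begin
    degree M i ≡⟨ degree-tri (suc j) (suc l) i ei (cong suc (trans (+-suc j l) e)) ⟩
    count (tri b (suc l)) (suc j) + count (tri b (suc j)) (suc l)
      ≡⟨ cong₂ _+_ (count-row l (suc j) (trans (eq j l) e)) (count-row j (suc l) (trans (+-suc j l) e)) ⟩
    count (tri b (suc l)) ⌊ suc j /2⌋ * 2 + count (tri b (suc j)) ⌊ suc l /2⌋ * 2
      ≡⟨ *-distribʳ-+ 2 (count (tri b (suc l)) ⌊ suc j /2⌋) _ ⟨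
    (count (tri b (suc l)) ⌊ suc j /2⌋ + count (tri b (suc j)) ⌊ suc l /2⌋) * 2 ∎
    where
    open ≡-Reasoning
    eq : ∀ j l → l + suc j ≡ suc (j + l)
    eq = solve-∀

  defect : ℕ → ℕ → Bool
  defect j l = (tri b l 0 xor tri b l ⌊ suc j /2⌋) xor (tri b j 0 xor tri b j ⌊ suc l /2⌋)

  odd-half-degree : ∀ j l →
    odd (count (tri b (suc l)) ⌊ suc j /2⌋ + count (tri b (suc j)) ⌊ suc l /2⌋) ≡ defect j l
  odd-half-degree j l = trans (odd-+ (count (tri b (suc l)) ⌊ suc j /2⌋) _)
    (cong₂ _xor_ (odd-count-xor (tri b l) ⌊ suc j /2⌋) (odd-count-xor (tri b j) ⌊ suc l /2⌋))

  defect-constant : RegularMod4 M → ∀ j l j′ l′ → suc (j + l) ≡ d → suc (j′ + l′) ≡ d →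
    defect j l ≡ defect j′ l′
  defect-constant reg j l j′ l′ e e′ = trans (sym (odd-half-degree j l)) (trans
    (*2%4-odd (halfdeg j l) (halfdeg j′ l′) (begin
      halfdeg j l * 2 % 4       ≡⟨ cong (_% 4) (degree-even j l i (toℕ-at _ p) e) ⟨
      degree M i % 4            ≡⟨ reg i i′ ⟩
      degree M i′ % 4           ≡⟨ cong (_% 4) (degree-even j′ l′ i′ (toℕ-at _ p′) e′) ⟩
      halfdeg j′ l′ * 2 % 4     ∎))
    (odd-half-degree j′ l′))
    where
    open ≡-Reasoning
    halfdeg : ℕ → ℕ → ℕ
    halfdeg j l = count (tri b (suc l)) ⌊ suc j /2⌋ + count (tri b (suc j)) ⌊ suc l /2⌋
    p : suc j ≤ suc d
    p = ≤-trans (≤-witness l e) (n≤1+n d)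
    p′ : suc j′ ≤ suc d
    p′ = ≤-trans (≤-witness l′ e′) (n≤1+n d)
    i = at (suc j) p
    i′ = at (suc j′) p′

  defect-zero⇒balanced : (∀ j l → suc (j + l) ≡ d → defect j l ≡ false) → IsBalanced d b
  defect-zero⇒balanced zeros j l e = begin
    tri b 1 j                          ≡⟨ xor-comm (b j) (b (suc j)) ⟩
    b (suc j) xor b j                  ≡⟨ cong₂ _xor_ left (sym (swap j 0 (suc l) (trans (eq₁ j l) e))) ⟩
    tri b l 0 xor tri b j 0            ≡⟨ xor-false⇒≡ _ _ (trans (sym (xor-interchange (tri b l 0) _ (tri b j 0) _)) (zeros j l e)) ⟩
    tri b l ⌊ suc j /2⌋ xor tri b j ⌊ suc l /2⌋ ∎
    where
    open ≡-Reasoning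
    eq₁ : ∀ j l → j + 0 + suc l ≡ suc (j + l)
    eq₁ = solve-∀
    eq₂ : ∀ j l → l + 0 + suc j ≡ suc (j + l)
    eq₂ = solve-∀
    left : b (suc j) ≡ tri b l 0
    left = trans (flip 0 (suc j) l e) (sym (swap l 0 (suc j) (trans (eq₂ j l) e)))

matrix-balanced : ∀ e (M : Matrix (3 + e * 2)) (st : IsSteinhaus M) (ms : IsMultiSymmetric M) →
  RegularMod4 M → IsBalanced (suc (e * 2)) (row M)
matrix-balanced zero M st ms reg zero zero refl = cong (row M 0 xor_) (flip 0 1 0 refl)
  where open Triangle 1 M st ms
matrix-balanced (suc e) M st ms reg = defect-zero⇒balanced λ j l p →
  trans (defect-constant reg j l 1 (suc (e * 2)) p refl) defect-1
  where
  open Triangle (suc (suc e * 2)) M st ms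
  open IsDihedral dihedral using (swap; corner; axis)
  eq₀ : ∀ e → suc (e * 2) + 1 + 1 ≡ suc (suc e * 2)
  eq₀ = solve-∀
  eq₁ : ∀ e → 1 + suc e + suc e ≡ suc (suc e * 2)
  eq₁ = solve-∀
  eq₂ : ∀ e → suc (e * 2) + 0 + 2 ≡ suc (suc e * 2)
  eq₂ = solve-∀
  eq₃ : ∀ e → 0 + suc (e * 2) + 2 ≡ suc (suc e * 2)
  eq₃ = solve-∀
  b₀ : b 0 ≡ false
  b₀ = corner (s≤s z≤n)
  b₁+b₂ : b 1 xor b 2 ≡ false
  b₁+b₂ = xor-cancelʳ _ (b 3) (begin
    b 3                                   ≡⟨ swap 0 3 (e * 2) refl ⟩
    tri b 3 0                             ≡⟨ tri-+2 b 1 0 ⟩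
    tri b 1 0 xor tri b 1 2               ≡⟨ cong (λ p → (p xor b 1) xor (b 2 xor b 3)) b₀ ⟩
    b 1 xor (b 2 xor b 3)                 ≡⟨ xor-assoc (b 1) (b 2) (b 3) ⟨
    (b 1 xor b 2) xor b 3                 ∎)
    where
    open ≡-Reasoning
  defect-1 : defect 1 (suc (e * 2)) ≡ false
  defect-1 = begin
    defect 1 (suc (e * 2))
      ≡⟨ cong₂ (λ p q → (tri b (suc (e * 2)) 0 xor p) xor ((b 0 xor b 1) xor q))
           (axis (e * 2) 1 (eq₀ e))
           (trans (cong (tri b 1 ∘ suc) (⌊n*2/2⌋≡n e)) (axis 0 (suc e) (eq₁ e))) ⟩
    (tri b (suc (e * 2)) 0 xor false) xor ((b 0 xor b 1) xor false)
      ≡⟨ cong₂ _xor_ (xor-identityʳ (tri b (suc (e * 2)) 0)) (trans (xor-identityʳ _) (cong (_xor b 1) b₀)) ⟩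
    tri b (suc (e * 2)) 0 xor b 1
      ≡⟨ cong (_xor b 1) (trans (swap (suc (e * 2)) 0 2 (eq₂ e)) (flip 0 (suc (e * 2)) 2 (eq₃ e))) ⟩
    b 2 xor b 1
      ≡⟨ xor-comm (b 2) (b 1) ⟩
    b 1 xor b 2
      ≡⟨ b₁+b₂ ⟩
    false ∎
    where open ≡-Reasoning

Admissible : ∀ {n} → Matrix n → Set
Admissible M = IsSteinhaus M × IsMultiSymmetric M × RegularMod4 M

dihedral-xor : ∀ {d b c} → IsDihedral d b → IsDihedral d c → IsDihedral d (λ y → b y xor c y)
dihedral-xor {b = b} {c} B C = record
  { swap = λ x y z e → trans (tri-xor b c x y)
      (trans (cong₂ _xor_ (IsDihedral.swap B x y z e) (IsDihedral.swap C x y z e)) (sym (tri-xor b c y x)))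
  ; flip = λ x y z e → trans (tri-xor b c x y)
      (trans (cong₂ _xor_ (IsDihedral.flip B x y z e) (IsDihedral.flip C x y z e)) (sym (tri-xor b c x z)))
  }

balanced-xor : ∀ {d b c} → IsBalanced d b → IsBalanced d c → IsBalanced d (λ y → b y xor c y)
balanced-xor {b = b} {c} B C j l e = begin
  tri δ 1 j                          ≡⟨ tri-xor b c 1 j ⟩
  tri b 1 j xor tri c 1 j            ≡⟨ cong₂ _xor_ (B j l e) (C j l e) ⟩
  (tri b l u xor tri b j v) xor (tri c l u xor tri c j v)
    ≡⟨ xor-interchange (tri b l u) (tri b j v) (tri c l u) (tri c j v) ⟩
  (tri b l u xor tri c l u) xor (tri b j v xor tri c j v)
    ≡⟨ cong₂ _xor_ (tri-xor b c l u) (tri-xor b c j v) ⟨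
  tri δ l u xor tri δ j v            ∎
  where
  δ : ℕ → Bool
  δ y = b y xor c y
  open ≡-Reasoning
  u = ⌊ suc j /2⌋
  v = ⌊ suc l /2⌋

code : ∀ {n} (ps : List Point) → Matrix (suc n) → Fin (length ps) → Bool
code ps M t = value (row M) (lookup ps t)

code-injective : ∀ e ps → Determining (suc (e * 2)) ps → ∀ (M N : Matrix (3 + e * 2)) →
  Admissible M → Admissible N → (∀ t → code ps M t ≡ code ps N t) → ∀ i j → M i j ≡ N i j
code-injective e ps det M N (stM , msM , regM) (stN , msN , regN) eq i j = entries
  where
  δ : ℕ → Bool
  δ y = row M y xor row N y
  agree : ∀ t → value δ (lookup ps t) ≡ false
  agree t = trans (tri-xor (row M) (row N) (proj₁ (lookup ps t)) _)
    (trans (cong (_xor code ps N t) (eq t)) (xor-same (code ps N t)))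
  δ-vanish : ∀ y → y ≤ suc (e * 2) → δ y ≡ false
  δ-vanish = det δ
    (dihedral-xor (Triangle.dihedral _ M stM msM) (Triangle.dihedral _ N stN msN))
    (balanced-xor {b = row M} {row N} (matrix-balanced e M stM msM regM) (matrix-balanced e N stN msN regN))
    (All.tabulate λ p∈ps → subst (λ p → value δ p ≡ false) (sym (lookup-index p∈ps)) (agree _))
  above : ∀ i j → toℕ i < toℕ j → M i j ≡ N i j
  above i j i<j = trans (sym (tri-entry M stM x y i j refl (sym ey)))
    (trans (xor-false⇒≡ _ _ (trans (sym (tri-xor (row M) (row N) x y))
      (trans (tri-vanish δ x y λ k _ k< → δ-vanish k (≤-trans (<⇒≤ k<) y+x≤)) (δ-vanish (y + x) y+x≤))))
      (tri-entry N stN x y i j refl (sym ey)))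
    where
    x = toℕ i
    y = toℕ j ∸ suc x
    ey : suc (x + y) ≡ toℕ j
    ey = m+[n∸m]≡n i<j
    y+x≤ : y + x ≤ suc (e * 2)
    y+x≤ = subst (_≤ suc (e * 2)) (+-comm x y)
      (≤-pred (≤-pred (subst (_< 3 + e * 2) (sym ey) (toℕ<n j))))
  entries : M i j ≡ N i j
  entries with <-cmp (toℕ i) (toℕ j)
  ... | tri< i<j _ _ = above i j i<j
  ... | tri≈ _ i≡j _ rewrite toℕ-injective i≡j = trans (proj₁ stM j) (sym (proj₁ stN j))
  ... | tri> _ _ j<i = trans (proj₂ (proj₂ stM) i j) (trans (above j i j<i) (proj₂ (proj₂ stN) j i))

allPairs-lookup : ∀ {A : Set} {R : A → A → Set} {L} → AllPairs R L →
  ∀ i j → toℕ i < toℕ j → R (lookup L i) (lookup L j)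
allPairs-lookup (r ∷ rs) 0F       (fsuc j) _         = All.lookup r (∈-lookup j)
allPairs-lookup (r ∷ rs) (fsuc i) (fsuc j) (s≤s i<j) = allPairs-lookup rs i j i<j

module _ {A : Set} {k : ℕ} (f : A → Fin k → Bool) where

  private
    toFin : A → Fin (2 ^ k)
    toFin x = funToFin (λ t → if f x t then 1F else 0F)

    toFin-injective : ∀ x y → toFin x ≡ toFin y → ∀ t → f x t ≡ f y t
    toFin-injective x y e t = bit-injective (f x t) (f y t)
      (trans (sym (finToFun-funToFin _ t)) (trans (cong (λ i → finToFun i t) e) (finToFun-funToFin _ t)))
      where
      bit-injective : ∀ p q → (Fin 2 ∋ (if p then 1F else 0F)) ≡ (if q then 1F else 0F) → p ≡ q
      bit-injective false false _ = refl
      bit-injective true  true  _ = refl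

  separated-length : ∀ L → AllPairs (λ x y → ¬ (∀ t → f x t ≡ f y t)) L → length L ≤ 2 ^ k
  separated-length L sep = injective⇒≤ {f = toFin ∘ lookup L} λ {i} {j} e → inj i j e
    where
    inj : ∀ i j → toFin (lookup L i) ≡ toFin (lookup L j) → i ≡ j
    inj i j e with <-cmp (toℕ i) (toℕ j)
    ... | tri< i<j _ _ = contradiction (toFin-injective _ _ e) (allPairs-lookup sep i j i<j)
    ... | tri≈ _ i≡j _ = toℕ-injective i≡j
    ... | tri> _ _ j<i = contradiction (toFin-injective _ _ (sym e)) (allPairs-lookup sep j i j<i)

distinct⇒separated : ∀ {n k} (f : Matrix n → Fin k → Bool) →
  (∀ M N → Admissible M → Admissible N → (∀ t → f M t ≡ f N t) → ∀ i j → M i j ≡ N i j) →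
  ∀ L → All Admissible L → AllPairs Distinct L → AllPairs (λ M N → ¬ (∀ t → f M t ≡ f N t)) L
distinct⇒separated f inj [] [] [] = []
distinct⇒separated f inj (M ∷ L) (aM ∷ as) (ds ∷ dss) =
  All.zipWith (λ (aN , M≢N) e → M≢N (inj M _ aM aN e)) (as , ds) ∷ distinct⇒separated f inj L as dss

≤-ceil30 : ∀ k n → k * 30 ≤ n + 29 → k ≤ ceil30 n
≤-ceil30 k n le = subst (_≤ ceil30 n) (m*n/n≡m k 30) (/-monoˡ-≤ 30 le)

length-admissible : ∀ e (L : List (Matrix (3 + e * 2))) → All Admissible L → AllPairs Distinct L →
  length L ≤ 2 ^ ceil30 (3 + e * 2)
length-admissible e L adm dist = from (determining-odd-short e)
  where
  eq : ∀ e → suc (e * 2) + 31 ≡ 3 + e * 2 + 29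
  eq = solve-∀
  from : (∃[ ps ] Determining (suc (e * 2)) ps × length ps * 30 ≤ suc (e * 2) + 31) →
    length L ≤ 2 ^ ceil30 (3 + e * 2)
  from (ps , det , len) = ≤-trans
    (separated-length (code ps) L (distinct⇒separated (code ps) (code-injective e ps det) L adm dist))
    (^-monoʳ-≤ 2 (≤-ceil30 (length ps) (3 + e * 2) (≤-trans len (≤-reflexive (eq e)))))

length-admissible-1 : (L : List (Matrix 1)) → All Admissible L → AllPairs Distinct L → length L ≤ 2 ^ 0
length-admissible-1 L adm dist = separated-length empty L (distinct⇒separated empty inj L adm dist)
  where
  empty : Matrix 1 → Fin 0 → Bool
  empty M ()
  inj : ∀ M N → Admissible M → Admissible N → (∀ t → empty M t ≡ empty N t) → ∀ i j → M i j ≡ N i j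
  inj M N (stM , _) (stN , _) _ 0F 0F = trans (proj₁ stM 0F) (sym (proj₁ stN 0F))

theorem6 : (n : ℕ) → n % 2 ≡ 1 → (L : List (Matrix n)) →
    All (λ M → IsSteinhaus M × IsMultiSymmetric M × RegularMod4 M) L →
    AllPairs Distinct L →
    length L ≤ 2 ^ ceil30 n
theorem6 n n-odd L adm dist with n divMod 2
... | result m 0F refl = contradiction (trans (sym (m*n%n≡0 m 2)) n-odd) λ ()
... | result zero 1F refl = ≤-trans (length-admissible-1 L adm dist) (s≤s z≤n)
... | result (suc e) 1F refl = length-admissible e L adm dist
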